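{- Let $k\ge 2$ and $n\ge 2$ be integers. Then the center of the $k$-Pell graph $\Pi_{n,k}$ is $$C(\Pi_{n,k})=\begin{cases}\Theta_n(k), & k\text{ even},\\ \Phi_n\!\left(\tfrac{k-1}{2},\tfrac{k+1}{2}\right), & k\text{ odd and } n\text{ even},\\ \Psi_n\!\left(\tfrac{k-1}{2},\tfrac{k+1}{2}\right), & k\text{ odd and } n\text{ odd}.\end{cases}$$ Further, $$|C(\Pi_{n,k})|=\begin{cases}F_{n+2}, & k\text{ even},\\ (n+4)\,2^{\frac{n}{2}-2}, & k\text{ odd and } n\text{ even},\\ 2^{\frac{n-1}{2}}, & k\text{ odd and } n\text{ odd}.\end{cases}$$ In addition, if $k$ is even, then the subgraph of $\Pi_{n,k}$ induced by $C(\Pi_{n,k})$ is isomorphic to the Fibonacci cube $\Gamma_n$.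
   Context: For an integer $k\ge 2$, a $k$-Pell string is a finite word over the alphabet $\{0,1,\ldots,k-1,kk\}$, i.e. a word over $\{0,1,\ldots,k\}$ in which every maximal run of the letter $k$ has even length. For $n\ge 0$, the $k$-Pell graph $\Pi_{n,k}$ has as vertices all $k$-Pell strings of length $n$, and two vertices are adjacent if one is obtained from the other either by replacing a single letter $i$ by $i+1$ (or vice versa) for some $i\in\{0,1,\ldots,k-2\}$, or by replacing one factor $(k-1)(k-1)$ by $kk$ (or vice versa), in such a way that the resulting string is again a $k$-Pell string. The center $C(G)$ of a graph is the set of vertices of minimum eccentricity. $F_m$ denotes the Fibonacci numbers ($F_0=0$, $F_1=1$, $F_m=F_{m-1}+F_{m-2}$). The Fibonacci cube $\Gamma_n$ is the graph whose vertices are binary strings of length $n$ with no two consecutive 1s, two being adjacent iff they differ in exactly one coordinate. For $k$ even, $\Theta_n(k)$ is the set of words $t_1\ldots t_n$ with every $t_i\in\{\frac k2-1,\frac k2\}$ and containing no two consecutive letters equal to $\frac k2-1$. For $n$ even and letters $a,b$, $\Phi_n(a,b)$ is the set of words of length $n$ that are concatenations of $n/2$ blocks from $\{aa,ab,ba\}$ (each block of length 2) such that no block $ba$ occurs before (to the left of) a block $ab$. For $n$ odd and letters $a,b$, $\Psi_n(a,b)$ is the set of words of length $n$ over $\{a,b\}$ that start and end with $a$, contain no factor $bb$, and in which every maximal run of $a$'s has odd length. Here $a=\frac{k-1}{2}$ and $b=\frac{k+1}{2}$ are regarded as letters (digits) of the alphabet $\{0,\ldots,k\}$. -}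

module Defs where

open import Level using (0ℓ)
open import Data.Bool.Base using (Bool; true)
open import Data.Fin.Base using (Fin)
open import Data.List.Base as List using (List; []; _∷_; _++_)
open import Data.List.Membership.Propositional using () renaming (_∈_ to _∈ˡ_)
open import Data.List.Relation.Unary.All using () renaming (All to Allˡ)
open import Data.List.Relation.Unary.AllPairs using (AllPairs)
open import Data.Maybe.Base using (just)
open import Data.Nat.Base using (ℕ; suc; _+_; _∸_; _/_; _<_; _≤_)
open import Data.Nat.Divisibility using (_∤_)
open import Data.Product.Base using (Σ-syntax; ∃-syntax; _×_; _,_; proj₁; proj₂)
open import Data.Sum.Base using (_⊎_; inj₁; inj₂; swap)
open import Data.Vec.Base using (Vec; []; _∷_; lookup; toList)
open import Data.Vec.Properties using (∷-injectiveʳ)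
open import Data.Vec.Relation.Unary.All using (All)
open import Data.Vec.Relation.Unary.Linked using (Linked)
open import Function.Bundles using (Inverse; _⇔_)
open import Relation.Binary.Bundles using (Setoid)
open import Relation.Binary.Core using (Rel)
open import Relation.Binary.Definitions using (Symmetric; Irreflexive; _Respects₂_)
import Relation.Binary.Construct.On as On
open import Relation.Binary.PropositionalEquality using (_≡_; _≢_; refl; sym; setoid)
open import Relation.Nullary using (¬_)
open import Relation.Unary using (Pred; _∈_)

-- Subsets are compared through the ambient equality, so membership proofs
-- never contribute extra elements.
subset : (S : Setoid 0ℓ 0ℓ) → Pred (Setoid.Carrier S) 0ℓ → Setoid 0ℓ 0ℓ
subset S P = On.setoid S (proj₁ {B = P})

HasCardinality : Setoid 0ℓ 0ℓ → ℕ → Set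
HasCardinality S m = Inverse (setoid (Fin m)) S

record Graph : Set₁ where
  field
    vertices : Setoid 0ℓ 0ℓ
  open Setoid vertices public using (_≈_) renaming (Carrier to Vertex)
  field
    Adj        : Rel Vertex 0ℓ
    adj-resp   : Adj Respects₂ _≈_
    adj-sym    : Symmetric Adj
    adj-irrefl : Irreflexive _≈_ Adj

infix 4 _≅_

record _≅_ (G H : Graph) : Set where
  private
    module G = Graph G
    module H = Graph H
  field
    bijection : Inverse G.vertices H.vertices
  open Inverse bijection using (to)
  field
    preserves : ∀ u v → G.Adj u v ⇔ H.Adj (to u) (to v)

induced : (G : Graph) → Pred (Graph.Vertex G) 0ℓ → Graph
induced G P = record
  { vertices   = subset vertices P
  ; Adj        = λ u v → Adj (proj₁ u) (proj₁ v)
  ; adj-resp   = (λ e → proj₁ adj-resp e) , (λ e → proj₂ adj-resp e)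
  ; adj-sym    = adj-sym
  ; adj-irrefl = adj-irrefl
  }
  where open Graph G

module _ (G : Graph) where
  open Graph G

  data Walk : Vertex → Vertex → ℕ → Set where
    done : ∀ {u v} → u ≈ v → Walk u v 0
    step : ∀ {u v w m} → Adj u v → Walk v w m → Walk u w (suc m)

  IsDistance : Vertex → Vertex → ℕ → Set
  IsDistance u v d = Walk u v d × (∀ m → Walk u v m → d ≤ m)

  IsEccentricity : Vertex → ℕ → Set
  IsEccentricity u e =
    (∀ v → ∃[ d ] IsDistance u v d × d ≤ e) × (∃[ v ] IsDistance u v e)

  Center : Pred Vertex 0ℓ
  Center u = ∃[ e ] IsEccentricity u e × (∀ v e′ → IsEccentricity v e′ → e ≤ e′)

-- Letters are natural numbers; IsPell k forces them into {0, …, k}.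
data IsPell (k : ℕ) : ∀ {n} → Vec ℕ n → Set where
  []     : IsPell k []
  letter : ∀ {n i} {w : Vec ℕ n} → i < k → IsPell k w → IsPell k (i ∷ w)
  double : ∀ {n} {w : Vec ℕ n} → IsPell k w → IsPell k (k ∷ k ∷ w)

data Raise (k : ℕ) : ∀ {n} → Vec ℕ n → Vec ℕ n → Set where
  incr  : ∀ {n i} {w : Vec ℕ n} → suc i < k → Raise k (i ∷ w) (suc i ∷ w)
  merge : ∀ {n j} {w : Vec ℕ n} → suc j ≡ k → Raise k (j ∷ j ∷ w) (k ∷ k ∷ w)
  there : ∀ {n x} {v w : Vec ℕ n} → Raise k v w → Raise k (x ∷ v) (x ∷ w)

raise-irrefl : ∀ {k n} {v w : Vec ℕ n} → v ≡ w → ¬ Raise k v w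
raise-irrefl ()   (incr _)
raise-irrefl refl (merge ())
raise-irrefl e    (there r) = raise-irrefl (∷-injectiveʳ e) r

PellGraph : (n k : ℕ) → Graph
PellGraph n k = record
  { vertices   = subset (setoid (Vec ℕ n)) (IsPell k)
  ; Adj        = λ u v → Raise k (proj₁ u) (proj₁ v) ⊎ Raise k (proj₁ v) (proj₁ u)
  ; adj-resp   = (λ { refl a → a }) , (λ { refl a → a })
  ; adj-sym    = swap
  ; adj-irrefl = λ { e (inj₁ r) → raise-irrefl e r ; e (inj₂ r) → raise-irrefl (sym e) r }
  }

PellCenter : (n k : ℕ) → Pred (Graph.Vertex (PellGraph n k)) 0ℓ
PellCenter n k = Center (PellGraph n k)

PellCenterWords : (n k : ℕ) → Pred (Vec ℕ n) 0ℓ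
PellCenterWords n k w = Σ[ p ∈ IsPell k w ] (w , p) ∈ PellCenter n k

NoTwoConsecutive : ∀ {A : Set} {n} → A → Pred (Vec A n) 0ℓ
NoTwoConsecutive c = Linked (λ s t → ¬ (s ≡ c × t ≡ c))

DifferInExactlyOne : ∀ {A : Set} {n} → Rel (Vec A n) 0ℓ
DifferInExactlyOne {n = n} u v =
  Σ[ i ∈ Fin n ] lookup u i ≢ lookup v i × (∀ j → j ≢ i → lookup u j ≡ lookup v j)

FibonacciCube : ℕ → Graph
FibonacciCube n = record
  { vertices   = subset (setoid (Vec Bool n)) (NoTwoConsecutive true)
  ; Adj        = λ u v → DifferInExactlyOne (proj₁ u) (proj₁ v)
  ; adj-resp   = (λ { refl a → a }) , (λ { refl a → a })
  ; adj-sym    = λ { (i , d , s) → i , (λ e → d (sym e)) , (λ j j≢i → sym (s j j≢i)) }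
  ; adj-irrefl = λ { refl (i , d , s) → d refl }
  }

F : ℕ → ℕ
F 0             = 0
F 1             = 1
F (suc (suc m)) = F (suc m) + F m

Θ : (n k : ℕ) → Pred (Vec ℕ n) 0ℓ
Θ n k w = All (λ t → t ≡ k / 2 ∸ 1 ⊎ t ≡ k / 2) w × NoTwoConsecutive (k / 2 ∸ 1) w

-- All blocks have length 2, so there are necessarily n / 2 of them.
Φ : (n a b : ℕ) → Pred (Vec ℕ n) 0ℓ
Φ n a b w = Σ[ blocks ∈ List (List ℕ) ]
    toList w ≡ List.concat blocks
  × Allˡ (_∈ˡ (aa ∷ ab ∷ ba ∷ [])) blocks
  × AllPairs (λ earlier later → ¬ (earlier ≡ ba × later ≡ ab)) blocks
  where
  aa ab ba : List ℕ
  aa = a ∷ a ∷ []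
  ab = a ∷ b ∷ []
  ba = b ∷ a ∷ []

MaximalRun : ∀ {A : Set} → A → List A → ℕ → Set
MaximalRun c w m = ∃[ xs ] ∃[ ys ]
    w ≡ xs ++ List.replicate m c ++ ys
  × 0 < m
  × List.last xs ≢ just c
  × List.head ys ≢ just c

Ψ : (n a b : ℕ) → Pred (Vec ℕ n) 0ℓ
Ψ n a b w =
    All (λ t → t ≡ a ⊎ t ≡ b) w
  × List.head (toList w) ≡ just a
  × List.last (toList w) ≡ just a
  × NoTwoConsecutive b w
  × (∀ m → MaximalRun a (toList w) m → 2 ∤ m)

{-# OPTIONS --safe #-}
-- Spelling each block kk as k(k-1) turns the distance of the Pell graph into the
-- ℓ¹-distance of words.  An opponent of x is then a tiling by single letters, of which
-- only 0 and k-1 matter, and dominoes kk.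
--
-- For k = 2h, every position alone lets the opponent gain h, with equality iff the letter
-- is h-1 or h, and a domino gains more than 2h exactly on two consecutive letters h-1.
--
-- For k = 2h+1, every pair of adjacent positions lets the opponent gain k (by 00 or by kk,
-- since the two distances sum to at least 2k-1), with equality iff the pair is aa, ab or ba
-- for a = h, b = h+1.  Peeling off pairs gives the radius ⌊nk/2⌋.  In odd length the first
-- letter can also be split off alone, which forces a in all odd positions; in even length a
-- leading b gains h+1 alone, so the rest has to be a central word of odd length.
module Submission where

open import Defs
open import Algebra.Properties.CommutativeSemigroup using (interchange; x∙yz≈y∙xz)
open import Data.Bool.Base using (Bool; true; false)
open import Data.Empty using (⊥)
open import Data.Fin.Base using (Fin; zero; suc)
open import Data.Fin.Properties using (suc-injective)
open import Data.List.Base as List using (List; []; _∷_; _++_; length)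
import Data.List.Properties as List
open import Data.List.Membership.Propositional using (_∈_)
open import Data.List.Membership.Propositional.Properties using (∈-lookup; ∈-map⁺; ∈-map⁻; ∈-++⁺ˡ; ∈-++⁺ʳ; ∈-++⁻)
open import Data.List.Relation.Unary.All as Allˡ using ([]; _∷_) renaming (All to Allˡ)
open import Data.List.Relation.Unary.All.Properties using (All¬⇒¬Any)
open import Data.List.Relation.Unary.AllPairs using (AllPairs; []; _∷_)
open import Data.List.Relation.Unary.Any using (here; there; index)
open import Data.List.Relation.Unary.Any.Properties using (lookup-index)
open import Data.List.Relation.Unary.Unique.Propositional using (Unique)
import Data.List.Relation.Unary.Unique.Propositional.Properties as Unique
open import Data.Maybe.Base using (just)
open import Data.Maybe.Properties using (just-injective)
open import Data.Nat.Base using (ℕ; zero; suc; _+_; _*_; _∸_; _^_; _/_; _≤_; _<_; z≤n; s≤s; ∣_-_∣)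
open import Data.Nat.DivMod using (m*n/n≡m)
open import Data.Nat.Divisibility using (_∣_; _∤_; divides; ∣⇒≤; ∣-refl; _∣0; ∣m+n∣m⇒∣n; ∣m∣n⇒∣m+n)
open import Data.Nat.Properties hiding (suc-injective)
open import Data.Nat.Tactic.RingSolver using (solve-∀)
open import Data.Product.Base using (_×_; ∃-syntax; Σ-syntax; _,_; proj₁; proj₂)
open import Data.Sum.Base as Sum using (_⊎_; inj₁; inj₂)
open import Data.Vec.Base as Vec using (Vec; []; _∷_; lookup; toList)
open import Data.Vec.Properties using (∷-injectiveˡ; ∷-injectiveʳ)
open import Data.Vec.Relation.Unary.All as All using (All; []; _∷_)
open import Data.Vec.Relation.Unary.Linked as Linked using ([]; [-]; _∷_)
open import Function.Base using (_∘_)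
open import Function.Bundles using (Inverse; mk⇔)
import Function.Construct.Composition as Composition
import Function.Construct.Symmetry as Symmetry
open import Level using (0ℓ)
open import Relation.Binary.Bundles using (Setoid)
open import Relation.Binary.Definitions using (tri<; tri≈; tri>)
open import Relation.Binary.PropositionalEquality using (_≡_; _≢_; refl; sym; trans; cong; cong₂; subst; subst₂; setoid; module ≡-Reasoning)
open import Relation.Nullary using (¬_; does; contradiction)
open import Relation.Nullary.Decidable using (dec-true; dec-false)
open import Relation.Unary using (Pred; _≐_)
open import Relation.Unary.Properties using (≐-trans)

-- Distances and eccentricities

module _ {G : Graph} where
  open Graph G
  private module V = Setoid vertices

  walk-respˡ : ∀ {u u′ v m} → u ≈ u′ → Walk G u v m → Walk G u′ v m
  walk-respˡ e (done u≈v)  = done (V.trans (V.sym e) u≈v)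
  walk-respˡ e (step a w) = step (proj₂ adj-resp e a) w

  walk-trans : ∀ {u v w l m} → Walk G u v l → Walk G v w m → Walk G u w (l + m)
  walk-trans (done u≈v) w = walk-respˡ (V.sym u≈v) w
  walk-trans (step a v) w = step a (walk-trans v w)

  walk-sym : ∀ {u v m} → Walk G u v m → Walk G v u m
  walk-sym {u} {v} {m} w = subst (Walk G v u) (+-identityʳ m) (reverse w (done V.refl))
    where
    reverse : ∀ {u v t l m} → Walk G u v l → Walk G u t m → Walk G v t (l + m)
    reverse (done u≈v) acc = walk-respˡ u≈v acc
    reverse {v = v} {t} {suc l} {m} (step a w) acc =
      subst (Walk G v t) (+-suc l m) (reverse w (step (adj-sym a) acc))

-- The ℓ¹-distance of words

D : ∀ {n} → Vec ℕ n → Vec ℕ n → ℕ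
D []       []       = 0
D (x ∷ xs) (y ∷ ys) = ∣ x - y ∣ + D xs ys

D-refl : ∀ {n} (xs : Vec ℕ n) → D xs xs ≡ 0
D-refl []       = refl
D-refl (x ∷ xs) = cong₂ _+_ (∣n-n∣≡0 x) (D-refl xs)

D-sym : ∀ {n} (xs ys : Vec ℕ n) → D xs ys ≡ D ys xs
D-sym []       []       = refl
D-sym (x ∷ xs) (y ∷ ys) = cong₂ _+_ (∣-∣-comm x y) (D-sym xs ys)

D-triangle : ∀ {n} (xs ys zs : Vec ℕ n) → D xs zs ≤ D xs ys + D ys zs
D-triangle []       []       []       = z≤n
D-triangle (x ∷ xs) (y ∷ ys) (z ∷ zs) = begin
  ∣ x - z ∣ + D xs zs                               ≤⟨ +-mono-≤ (∣-∣-triangle x y z) (D-triangle xs ys zs) ⟩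
  (∣ x - y ∣ + ∣ y - z ∣) + (D xs ys + D ys zs)     ≡⟨ interchange +-commutativeSemigroup ∣ x - y ∣ _ _ _ ⟩
  (∣ x - y ∣ + D xs ys) + (∣ y - z ∣ + D ys zs)     ∎
  where open ≤-Reasoning

∣-∣-least : ∀ {m n o} → m ≤ n + o → n ≤ m + o → ∣ m - n ∣ ≤ o
∣-∣-least {m} {n} m≤n+o n≤m+o with ∣m-n∣≡[m∸n]∨[n∸m] m n
... | inj₁ e rewrite e = m≤n+o⇒m∸n≤o m n m≤n+o
... | inj₂ e rewrite e = m≤n+o⇒m∸n≤o n m n≤m+o

∣-∣-greatest : ∀ {m n o} → m + o ≤ n → o ≤ ∣ m - n ∣
∣-∣-greatest {m} {n} m+o≤n = +-cancelˡ-≤ m _ _ (≤-trans m+o≤n (m≤n+∣n-m∣ n m))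

∣1+n-n∣≡1 : ∀ n → ∣ suc n - n ∣ ≡ 1
∣1+n-n∣≡1 zero    = refl
∣1+n-n∣≡1 (suc n) = ∣1+n-n∣≡1 n

∣n-1+n∣≡1 : ∀ n → ∣ n - suc n ∣ ≡ 1
∣n-1+n∣≡1 n = trans (∣-∣-comm n (suc n)) (∣1+n-n∣≡1 n)

∣1+m-n∣≡1+∣m-n∣ : ∀ {m n} → n ≤ m → ∣ suc m - n ∣ ≡ suc ∣ m - n ∣
∣1+m-n∣≡1+∣m-n∣ {m} {n} n≤m
  rewrite m≤n⇒∣n-m∣≡n∸m n≤m | m≤n⇒∣n-m∣≡n∸m (m≤n⇒m≤1+n n≤m) = +-∸-assoc 1 n≤m

-- Codes of Pell strings and distances in the Pell graph

module Pell (κ : ℕ) where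

  k : ℕ
  k = suc κ

  Vertex : ℕ → Set
  Vertex n = Graph.Vertex (PellGraph n k)

  -- With `k k` spelled `k κ`, merging `κ κ` raises a single letter by one, exactly as an ordinary
  -- increment does.
  encode : ∀ {n} {w : Vec ℕ n} → IsPell k w → Vec ℕ n
  encode []                   = []
  encode (letter {i = i} _ p) = i ∷ encode p
  encode (double p)           = k ∷ κ ∷ encode p

  code : ∀ {n} → Vertex n → Vec ℕ n
  code u = encode (proj₂ u)

  -- A letter `k` can never be read as a single letter, so the parse into letters and blocks is
  -- forced. This is needed because vertices are compared by their words alone.
  encode-irrelevant : ∀ {n} {w : Vec ℕ n} (p q : IsPell k w) → encode p ≡ encode q
  encode-irrelevant []           []           = refl
  encode-irrelevant (letter _ p) (letter _ q) = cong (_ ∷_) (encode-irrelevant p q)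
  encode-irrelevant (letter l _) (double _)   = contradiction l (<-irrefl refl)
  encode-irrelevant (double _)   (letter l _) = contradiction l (<-irrefl refl)
  encode-irrelevant (double p)   (double q)   = cong (λ z → k ∷ κ ∷ z) (encode-irrelevant p q)

  encode-resp : ∀ {n} {u v : Vec ℕ n} (p : IsPell k u) (q : IsPell k v) → u ≡ v → encode p ≡ encode q
  encode-resp p q refl = encode-irrelevant p q

  -- The letters before the move are shared and every `k` forces a block, so both parses agree up to
  -- the move, where the codes differ by one in one letter.
  raise⇒D≡1 : ∀ {n} {u v : Vec ℕ n} → Raise k u v → (p : IsPell k u) (q : IsPell k v) → D (encode p) (encode q) ≡ 1
  raise⇒D≡1 (incr {i = i} _) (letter _ p) (letter _ q)
    rewrite encode-irrelevant p q | D-refl (encode q) | ∣n-1+n∣≡1 i = refl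
  raise⇒D≡1 (incr l) (double p) _          = contradiction (<-trans (n<1+n _) l) (<-irrefl refl)
  raise⇒D≡1 (incr l) _          (double q) = contradiction l (<-irrefl refl)
  raise⇒D≡1 (merge refl) (letter _ (letter _ p)) (double q)
    rewrite encode-irrelevant p q | D-refl (encode q) | ∣n-1+n∣≡1 κ | ∣n-n∣≡0 κ = refl
  raise⇒D≡1 (merge refl) _ (letter l _) = contradiction l (<-irrefl refl)
  raise⇒D≡1 (there {x = x} r) (letter _ p) (letter _ q) rewrite ∣n-n∣≡0 x = raise⇒D≡1 r p q
  raise⇒D≡1 (there r) (letter l p) (double q) = contradiction l (<-irrefl refl)
  raise⇒D≡1 (there r) (double p) (letter l q) = contradiction l (<-irrefl refl)
  raise⇒D≡1 (there (there r)) (double p) (double q) rewrite ∣n-n∣≡0 κ = raise⇒D≡1 r p q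

  D≤walk : ∀ {n m} {u v : Vertex n} → Walk (PellGraph n k) u v m → D (code u) (code v) ≤ m
  D≤walk {u = u} {v} (done e)
    rewrite encode-resp (proj₂ u) (proj₂ v) e = ≤-reflexive (D-refl (code v))
  D≤walk {u = u} {w} (step {v = v} a t) =
    ≤-trans (D-triangle (code u) (code v) (code w)) (+-mono-≤ (adj a) (D≤walk t))
    where
    adj : Graph.Adj (PellGraph _ k) u v → D (code u) (code v) ≤ 1
    adj (inj₁ r) = ≤-reflexive (raise⇒D≡1 r (proj₂ u) (proj₂ v))
    adj (inj₂ r) = ≤-reflexive (trans (D-sym (code u) (code v)) (raise⇒D≡1 r (proj₂ v) (proj₂ u)))

  module _ {n : ℕ} where
    private G = PellGraph n k ; G⁺ = PellGraph (suc n) k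

    prepend : ∀ {i} (l : i < k) {u v : Vertex n} {m} → Walk G u v m →
              Walk G⁺ (_ , letter l (proj₂ u)) (_ , letter l (proj₂ v)) m
    prepend l (done e)   = done (cong (_ ∷_) e)
    prepend l (step a t) = step (Sum.map there there a) (prepend l t)

    prepend² : {u v : Vertex n} {m : ℕ} → Walk G u v m →
               Walk (PellGraph (suc (suc n)) k) (_ , double (proj₂ u)) (_ , double (proj₂ v)) m
    prepend² (done e)   = done (cong (λ w → k ∷ k ∷ w) e)
    prepend² (step a t) = step (Sum.map there² there² a) (prepend² t)
      where
      there² : ∀ {n x y} {v w : Vec ℕ n} → Raise k v w → Raise k (x ∷ y ∷ v) (x ∷ y ∷ w)
      there² r = there (there r)

    descend : ∀ d {i} (l : i < k) (l′ : d + i < k) (u : Vertex n) →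
              Walk G⁺ (_ , letter l′ (proj₂ u)) (_ , letter l (proj₂ u)) d
    descend zero    l l′ u = done refl
    descend (suc d) l l′ u = step (inj₂ (incr l′)) (descend d l (<-trans (n<1+n _) l′) u)

    descend-to : ∀ {i j} (l : i < k) (l′ : j < k) → i ≤ j → (u : Vertex n) →
                 Walk G⁺ (_ , letter l′ (proj₂ u)) (_ , letter l (proj₂ u)) ∣ j - i ∣
    descend-to {i} {j} l l′ i≤j u =
      subst (Walk G⁺ _ _) (sym (m≤n⇒∣n-m∣≡n∸m i≤j))
        (walk-respˡ (cong (_∷ proj₁ u) (m∸n+n≡m i≤j))
          (descend (j ∸ i) l (subst (_< k) (sym (m∸n+n≡m i≤j)) l′) u))

    change : ∀ {i j} (l : i < k) (l′ : j < k) (u : Vertex n) →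
             Walk G⁺ (_ , letter l (proj₂ u)) (_ , letter l′ (proj₂ u)) ∣ i - j ∣
    change {i} {j} l l′ u with ≤-total i j
    ... | inj₁ i≤j = subst (Walk G⁺ _ _) (∣-∣-comm j i) (walk-sym (descend-to l l′ i≤j u))
    ... | inj₂ j≤i = descend-to l′ l j≤i u

  κ<k : κ < k
  κ<k = n<1+n κ

  -- The block becomes `κ κ` in one move, and lowering the first `κ` to `i` costs `∣ κ - i ∣`;
  -- together this is `∣ k - i ∣` because `i ≤ κ`. The second `κ` stays in front of `u` as an
  -- ordinary letter, where `t` starts.
  split : ∀ {n i m} (l : i < k) (u : Vertex n) (v : Vertex (suc n)) →
          Walk (PellGraph (suc n) k) (_ , letter κ<k (proj₂ u)) v m →
          Walk (PellGraph (suc (suc n)) k) (_ , double (proj₂ u)) (_ , letter l (proj₂ v)) (∣ k - i ∣ + m)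
  split {i = i} {m} l@(s≤s i≤κ) u v t =
    subst (Walk _ _ _) (cong (_+ m) (sym (∣1+m-n∣≡1+∣m-n∣ i≤κ)))
      (step (inj₂ (merge refl)) (walk-trans (change κ<k l (_ , letter κ<k (proj₂ u))) (prepend l t)))

  -- If only one of the words starts with `k k`, its block is split and the recursion compares the
  -- words after their first letters. The former block then contributes the letter `κ`, just as in
  -- its code. Two leading blocks need no move at all.
  geodesic : ∀ n (u v : Vertex n) → Walk (PellGraph n k) u v (D (code u) (code v))
  geodesic zero    (_ , [])         (_ , [])          = done refl
  geodesic (suc n) (_ , letter l p) (_ , letter l′ q) =
    walk-trans (change l l′ (_ , p)) (prepend l′ (geodesic n (_ , p) (_ , q)))
  geodesic (suc (suc n)) (_ , double p) (_ , letter l q) =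
    split l (_ , p) (_ , q) (geodesic (suc n) (_ , letter κ<k p) (_ , q))
  geodesic (suc (suc n)) u@(_ , letter l p) v@(_ , double q) =
    subst (Walk _ _ _) (D-sym (code v) (code u))
      (walk-sym (split l (_ , q) (_ , p)
        (subst (Walk _ _ _) (D-sym (encode p) (κ ∷ encode q))
          (walk-sym (geodesic (suc n) (_ , p) (_ , letter κ<k q))))))
  geodesic (suc (suc n)) (_ , double p) (_ , double q)
    rewrite ∣n-n∣≡0 κ = prepend² (geodesic n (_ , p) (_ , q))

  D-isDistance : ∀ {n} (u v : Vertex n) → IsDistance (PellGraph n k) u v (D (code u) (code v))
  D-isDistance u v = geodesic _ u v , λ m → D≤walk

  isDistance⇒≡D : ∀ {n d} {u v : Vertex n} → IsDistance (PellGraph n k) u v d → d ≡ D (code u) (code v)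
  isDistance⇒≡D {u = u} {v} (w , least) = ≤-antisym (least _ (geodesic _ u v)) (D≤walk w)

  -- The eccentricity of u is the largest s with Reach (code u) s, and the least R with Within (code u) R.
  record Reach {n} (xs : Vec ℕ n) (s : ℕ) : Set where
    constructor reached
    field
      opponent : Vertex n
      far      : s ≤ D xs (code opponent)

  record Within {n} (xs : Vec ℕ n) (R : ℕ) : Set where
    constructor within
    field
      near : ∀ (v : Vertex n) → D xs (code v) ≤ R

  open Within

  reach≤within : ∀ {n} {xs : Vec ℕ n} {s R} → Within xs R → Reach xs s → s ≤ R
  reach≤within wi (reached v s≤) = ≤-trans s≤ (near wi v)

  reach-weaken : ∀ {n} {xs : Vec ℕ n} {s t} → s ≤ t → Reach xs t → Reach xs s
  reach-weaken s≤t (reached v t≤) = reached v (≤-trans s≤t t≤)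

  -- This peels letters off a bound: an opponent of the tail gaining more than `R` would extend to
  -- one gaining more than `c + R`.
  within-cancel : ∀ {n m} {xs : Vec ℕ n} {ys : Vec ℕ m} c {R} →
                  (∀ {s} → Reach xs s → Reach ys (c + s)) → Within ys (c + R) → Within xs R
  within-cancel c extend wi = within λ v →
    +-cancelˡ-≤ c _ _ (reach≤within wi (extend (reached v ≤-refl)))

  reach-[] : Reach [] 0
  reach-[] = reached ([] , []) z≤n

  -- Opponents are assembled from three pieces only: `0` here, then `κ`, then the block `k k`, which
  -- is compared through its code `k κ`.
  reach-low : ∀ {n} {xs : Vec ℕ n} {s} x → Reach xs s → Reach (x ∷ xs) (x + s)
  reach-low x (reached (w , p) s≤) =
    reached (0 ∷ w , letter (s≤s z≤n) p) (+-mono-≤ (≤-reflexive (sym (∣-∣-identityʳ x))) s≤)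

  reach-high : ∀ {n} {xs : Vec ℕ n} {s} x → Reach xs s → Reach (x ∷ xs) (∣ x - κ ∣ + s)
  reach-high x (reached (w , p) s≤) = reached (κ ∷ w , letter κ<k p) (+-monoʳ-≤ ∣ x - κ ∣ s≤)

  reach-double : ∀ {n} {xs : Vec ℕ n} {s} x y → Reach xs s → Reach (x ∷ y ∷ xs) (∣ x - k ∣ + (∣ y - κ ∣ + s))
  reach-double x y (reached (w , p) s≤) =
    reached (k ∷ k ∷ w , double p) (+-monoʳ-≤ ∣ x - k ∣ (+-monoʳ-≤ ∣ y - κ ∣ s≤))

  isEccentricity : ∀ {n R} (u : Vertex n) → Within (code u) R → Reach (code u) R → IsEccentricity (PellGraph n k) u R
  isEccentricity u wi (reached v R≤) =
    (λ v → _ , D-isDistance u v , near wi v) ,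
    (v , subst (IsDistance _ u v) (≤-antisym (near wi v) R≤) (D-isDistance u v))

  isEccentricity⇒within : ∀ {n e} (u : Vertex n) → IsEccentricity (PellGraph n k) u e → Within (code u) e
  isEccentricity⇒within u (dist , _) = within λ v →
    let d , isd , d≤e = dist v in subst (_≤ _) (isDistance⇒≡D isd) d≤e

  encode-letters : ∀ {n} {w : Vec ℕ n} → All (_< k) w → (p : IsPell k w) → encode p ≡ w
  encode-letters []       []           = refl
  encode-letters (_ ∷ a)  (letter _ p) = cong (_ ∷_) (encode-letters a p)
  encode-letters (l ∷ _)  (double _)   = contradiction l (<-irrefl refl)

  letters-encode : ∀ {n} {w : Vec ℕ n} (p : IsPell k w) → All (_< k) (encode p) → encode p ≡ w
  letters-encode []           []      = refl
  letters-encode (letter _ p) (_ ∷ a) = cong (_ ∷_) (letters-encode p a)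
  letters-encode (double _)   (l ∷ _) = contradiction l (<-irrefl refl)

  letters-isPell : ∀ {n} {w : Vec ℕ n} → All (_< k) w → IsPell k w
  letters-isPell []      = []
  letters-isPell (l ∷ a) = letter l (letters-isPell a)

  -- Every word reaches `R`, so no eccentricity is below `R`. A word in `T` has no letter `k`, hence
  -- is its own code, and the given word in `T` shows that `R` is attained. Conversely, the code of
  -- a central vertex stays within `R`, so it lies in `T`, contains no `k`, and therefore equals the
  -- word of the vertex.
  center-characterisation : ∀ {n} (T : Pred (Vec ℕ n) 0ℓ) (R : ℕ) →
    (∀ {w} → T w → All (_< k) w) → (∀ xs → Reach xs R) →
    (∀ {xs} → T xs → Within xs R) → (∀ {xs} → Within xs R → T xs) →
    ∃[ w ] T w → PellCenterWords n k ≐ T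
  center-characterisation {n} T R small reach sound complete (w₀ , t₀) = forth , back
    where
    vertex : ∀ {w} → T w → Vertex n
    vertex t = _ , letters-isPell (small t)

    T-within : ∀ {w} (t : T w) (p : IsPell k w) → Within (encode p) R
    T-within t p = subst (λ xs → Within xs R) (sym (encode-letters (small t) p)) (sound t)

    forth : ∀ {w} → PellCenterWords n k w → T w
    forth {w} (p , e , ecc , least) = subst T (letters-encode p (small t)) t
      where
      e≤R : e ≤ R
      e≤R = least (vertex t₀) R (isEccentricity (vertex t₀) (T-within t₀ _) (reach _))

      t : T (encode p)
      t = complete (within λ v → ≤-trans (near (isEccentricity⇒within (w , p) ecc) v) e≤R)

    back : ∀ {w} → T w → PellCenterWords n k w
    back {w} t = proj₂ (vertex t) , R , isEccentricity (vertex t) (T-within t _) (reach _) ,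
      λ v e′ ecc → reach≤within (isEccentricity⇒within v ecc) (reach (code v))

lookup-ext : ∀ {A : Set} {n} (xs ys : Vec A n) → (∀ i → lookup xs i ≡ lookup ys i) → xs ≡ ys
lookup-ext []       []       _ = refl
lookup-ext (x ∷ xs) (y ∷ ys) e = cong₂ _∷_ (e zero) (lookup-ext xs ys (e ∘ suc))

-- Enumerations

record Enumeration {A : Set} (P : Pred A 0ℓ) : Set where
  field
    list     : List A
    unique   : Unique list
    sound    : ∀ {x} → x ∈ list → P x
    complete : ∀ {x} → P x → x ∈ list

open Enumeration

size : ∀ {A} {P : Pred A 0ℓ} → Enumeration P → ℕ
size E = length (list E)

lookup-injective : ∀ {A : Set} {xs : List A} → Unique xs → ∀ {i j} → List.lookup xs i ≡ List.lookup xs j → i ≡ j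
lookup-injective (_ ∷ u)  {zero}  {zero}  _ = refl
lookup-injective (x∉ ∷ _) {zero}  {suc j} e = contradiction (subst (_∈ _) (sym e) (∈-lookup j)) (All¬⇒¬Any x∉)
lookup-injective (x∉ ∷ _) {suc i} {zero}  e = contradiction (subst (_∈ _) e (∈-lookup i)) (All¬⇒¬Any x∉)
lookup-injective (_ ∷ u)  {suc i} {suc j} e = cong suc (lookup-injective u e)

-- Since `subset` ignores membership proofs, it is enough that indices correspond to the bare
-- elements of the list.
enumeration⇒cardinality : ∀ {A} {P : Pred A 0ℓ} (E : Enumeration P) → HasCardinality (subset (setoid A) P) (size E)
enumeration⇒cardinality {A} {P} E = record
  { to        = to
  ; from      = from
  ; to-cong   = λ { refl → refl }
  ; from-cong = λ {x} {y} e → lookup-injective (unique E) (trans (to∘from x) (trans e (sym (to∘from y))))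
  ; inverse   = (λ { {x} refl → to∘from x }) , λ {i} {x} e → lookup-injective (unique E) (trans (to∘from x) e)
  }
  where
  to : Fin (size E) → Σ[ x ∈ A ] P x
  to i = List.lookup (list E) i , sound E (∈-lookup i)

  from : Σ[ x ∈ A ] P x → Fin (size E)
  from (x , px) = index (complete E px)

  to∘from : ∀ x → proj₁ (to (from x)) ≡ proj₁ x
  to∘from (x , px) = sym (lookup-index (complete E px))

singleton : ∀ {A : Set} {P : Pred A 0ℓ} x → P x → (∀ {y} → P y → y ≡ x) → Enumeration P
singleton x px only = record
  { list     = x ∷ []
  ; unique   = [] ∷ []
  ; sound    = λ { (here refl) → px }
  ; complete = λ py → here (only py)
  }

module _ {A B C : Set} {P : Pred A 0ℓ} {Q : Pred B 0ℓ} {R : Pred C 0ℓ}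
  (f : A → C) (g : B → C)
  (f-injective : ∀ {x y} → f x ≡ f y → x ≡ y) (g-injective : ∀ {x y} → g x ≡ g y → x ≡ y)
  (f≢g : ∀ {x y} → f x ≢ g y)
  (f-sound : ∀ {x} → P x → R (f x)) (g-sound : ∀ {y} → Q y → R (g y))
  (cases : ∀ {z} → R z → (∃[ x ] z ≡ f x × P x) ⊎ (∃[ y ] z ≡ g y × Q y))
  where

  -- Each counting recursion below splits words by their first letters into two disjoint injective
  -- images, so that the sizes add up.
  union : Enumeration P → Enumeration Q → Enumeration R
  union E E′ = record
    { list     = fs ++ gs
    ; unique   = Unique.++⁺ (Unique.map⁺ f-injective (unique E)) (Unique.map⁺ g-injective (unique E′)) disjoint
    ; sound    = sound′ ∘ ∈-++⁻ fs
    ; complete = complete′ ∘ cases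
    }
    where
    fs gs : List C
    fs = List.map f (list E)
    gs = List.map g (list E′)

    disjoint : ∀ {z} → z ∈ fs × z ∈ gs → ⊥
    disjoint (z∈fs , z∈gs) with ∈-map⁻ f z∈fs | ∈-map⁻ g z∈gs
    ... | _ , _ , refl | _ , _ , e = f≢g e

    sound′ : ∀ {z} → z ∈ fs ⊎ z ∈ gs → R z
    sound′ (inj₁ z∈fs) with ∈-map⁻ f z∈fs
    ... | _ , x∈ , refl = f-sound (sound E x∈)
    sound′ (inj₂ z∈gs) with ∈-map⁻ g z∈gs
    ... | _ , y∈ , refl = g-sound (sound E′ y∈)

    complete′ : ∀ {z} → (∃[ x ] z ≡ f x × P x) ⊎ (∃[ y ] z ≡ g y × Q y) → z ∈ fs ++ gs
    complete′ (inj₁ (_ , refl , px)) = ∈-++⁺ˡ (∈-map⁺ f (complete E px))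
    complete′ (inj₂ (_ , refl , qy)) = ∈-++⁺ʳ fs (∈-map⁺ g (complete E′ qy))

length-map-++-map : ∀ {A B C : Set} {f : A → C} {g : B → C} (xs : List A) (ys : List B) →
                    length (List.map f xs ++ List.map g ys) ≡ length xs + length ys
length-map-++-map {f = f} {g} xs ys =
  trans (List.length-++ (List.map f xs)) (cong₂ _+_ (List.length-map f xs) (List.length-map g ys))

-- From sets of words to the center

CenterSetoid : (n k : ℕ) → Setoid 0ℓ 0ℓ
CenterSetoid n k = subset (Graph.vertices (PellGraph n k)) (PellCenter n k)

words↔center : ∀ {n k} {T : Pred (Vec ℕ n) 0ℓ} → PellCenterWords n k ≐ T →
               Inverse (subset (setoid (Vec ℕ n)) T) (CenterSetoid n k)
words↔center (forth , back) = record
  { to        = λ { (w , t) → let p , c = back t in (w , p) , c }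
  ; from      = λ { ((w , p) , c) → w , forth (p , c) }
  ; to-cong   = λ e → e
  ; from-cong = λ e → e
  ; inverse   = (λ e → e) , (λ e → e)
  }

center-cardinality : ∀ {n k} {T : Pred (Vec ℕ n) 0ℓ} → PellCenterWords n k ≐ T →
                     (E : Enumeration T) → HasCardinality (CenterSetoid n k) (size E)
center-cardinality eq E = Composition.inverse (enumeration⇒cardinality E) (words↔center eq)

-- Even k

module EvenCase (l : ℕ) where

  -- Here `k = suc (l + h) = 2h`, so `l` and `h` are the letters `k / 2 ∸ 1` and `k / 2`.
  h : ℕ
  h = suc l

  open Pell (l + h)

  Letter : Pred ℕ 0ℓ
  Letter t = t ≡ l ⊎ t ≡ h

  Central : ∀ {n} → Pred (Vec ℕ n) 0ℓ
  Central w = All Letter w × NoTwoConsecutive l w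

  letter<k : ∀ {x} → Letter x → x < k
  letter<k (inj₁ refl) = s≤s (m≤m+n l h)
  letter<k (inj₂ refl) = s≤s (m≤n+m h l)

  -- A letter up to `l` is at least `h` away from `κ = l + h`; any larger letter is at least `h`
  -- away from `0`.
  reach-∷ : ∀ {n} {xs : Vec ℕ n} {s} x → Reach xs s → Reach (x ∷ xs) (h + s)
  reach-∷ {s = s} x r with ≤-<-connex x l
  ... | inj₁ x≤l = reach-weaken (+-monoˡ-≤ s (∣-∣-greatest (+-monoˡ-≤ h x≤l))) (reach-high x r)
  ... | inj₂ h≤x = reach-weaken (+-monoˡ-≤ s h≤x) (reach-low x r)

  reach : ∀ {n} (xs : Vec ℕ n) → Reach xs (n * h)
  reach []       = reach-[]
  reach (x ∷ xs) = reach-∷ x (reach xs)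

  single-bound : ∀ {x i} → Letter x → i < k → ∣ x - i ∣ ≤ h
  single-bound {x} {i} t (s≤s i≤κ) = ∣-∣-least (≤-trans (x≤h t) (m≤n+m h i)) (≤-trans i≤κ (+-monoˡ-≤ h (l≤x t)))
    where
    x≤h : ∀ {x} → Letter x → x ≤ h
    x≤h (inj₁ refl) = n≤1+n l
    x≤h (inj₂ refl) = ≤-refl
    l≤x : ∀ {x} → Letter x → l ≤ x
    l≤x (inj₁ refl) = ≤-refl
    l≤x (inj₂ refl) = n≤1+n l

  -- A first letter `h` yields exactly `h` against `k`, and the second letter at most `h`. In the
  -- pair `l h` the first letter yields `h + 1`, but the second only `l`, which again makes `2h`.
  double-bound : ∀ {x y R r} → Letter x → Letter y → ¬ (x ≡ l × y ≡ l) → r ≤ R →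
                 ∣ x - k ∣ + (∣ y - (l + h) ∣ + r) ≤ h + (h + R)
  double-bound (inj₁ refl) (inj₁ refl) ¬ll _ = contradiction (refl , refl) ¬ll
  double-bound {R = R} {r} (inj₁ refl) (inj₂ refl) _ r≤R
    rewrite sym (+-suc l h) | ∣m-m+n∣≡n l (suc h) | ∣-∣-comm h (l + h) | +-comm l h | ∣-∣-comm (h + l) h | ∣m-m+n∣≡n h l =
    s≤s (≤-trans (≤-reflexive (sym (+-suc l (l + r)))) (+-monoʳ-≤ l (s≤s (+-monoʳ-≤ l r≤R))))
  double-bound (inj₂ refl) y _ r≤R
    rewrite ∣m-m+n∣≡n l h = +-monoʳ-≤ h (+-mono-≤ (single-bound y ≤-refl) r≤R)

  central-bound : ∀ {n} {xs w : Vec ℕ n} → Central xs → (p : IsPell k w) → D xs (encode p) ≤ n * h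
  central-bound ([]         , _)       []            = z≤n
  central-bound (a ∷ as     , ls)      (letter i<k p) = +-mono-≤ (single-bound a i<k) (central-bound (as , Linked.tail ls) p)
  central-bound (a ∷ b ∷ as , ab ∷ ls) (double p)     = double-bound a b ab (central-bound (as , Linked.tail ls) p)

  -- The opponent starting with `0` forces `x ≤ h`, the one starting with `κ = l + h` forces
  -- `l ≤ x`.
  first-letter : ∀ {n x R} {xs : Vec ℕ n} → Within (x ∷ xs) (h + R) → Reach xs R → Letter x
  first-letter {x = x} {R} wi r with m≤n⇒m<n∨m≡n x≤h
    where
    x≤h : x ≤ h
    x≤h = +-cancelʳ-≤ R _ _ (reach≤within wi (reach-low x r))
  ... | inj₂ x≡h       = inj₂ x≡h
  ... | inj₁ (s≤s x≤l) = inj₁ (≤-antisym x≤l (+-cancelʳ-≤ h _ _ (≤-trans (m≤n+∣n-m∣ (l + h) x)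
      (+-monoʳ-≤ x (+-cancelʳ-≤ R _ _ (reach≤within wi (reach-high x r)))))))

  -- The block `k k` gains `h + 1` on the first `l` and `h` on the second, one more than allowed.
  no-ll : ∀ {n R} {xs : Vec ℕ n} → Reach xs R → ¬ Within (l ∷ l ∷ xs) (h + (h + R))
  no-ll {R = R} r wi = 1+n≰n (≤-trans
    (+-mono-≤ (∣-∣-greatest {l} {o = suc h} (≤-reflexive (+-suc l h))) (+-monoˡ-≤ R (∣-∣-greatest {l} {o = h} ≤-refl)))
    (reach≤within wi (reach-double l l r)))

  within⇒central : ∀ {n} (xs : Vec ℕ n) → Within xs (n * h) → Central xs
  within⇒central []       _  = [] , []
  within⇒central (x ∷ []) wi = first-letter wi reach-[] ∷ [] , [-]
  within⇒central (x ∷ xs@(y ∷ ys)) wi with within⇒central xs (within-cancel h (reach-∷ x) wi)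
  ... | as , ls = first-letter wi (reach xs) ∷ as , (λ { (refl , refl) → no-ll (reach ys) wi }) ∷ ls

  constant-central : ∀ n → Central (Vec.replicate n h)
  constant-central zero          = [] , []
  constant-central (suc zero)    = inj₂ refl ∷ [] , [-]
  constant-central (suc (suc n)) with constant-central (suc n)
  ... | as , ls = inj₂ refl ∷ as , (λ { (() , _) }) ∷ ls

  center : ∀ n → PellCenterWords n k ≐ Central
  center n = center-characterisation Central (n * h) (λ t → All.map letter<k (proj₁ t)) reach
    (λ t → within λ v → central-bound t (proj₂ v)) (within⇒central _) (_ , constant-central n)

  cons-h : ∀ {n} {w : Vec ℕ n} → Central w → Central (h ∷ w)
  cons-h {w = []}    (as , ls) = inj₂ refl ∷ as , [-]
  cons-h {w = _ ∷ _} (as , ls) = inj₂ refl ∷ as , (λ { (() , _) }) ∷ ls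

  cons-lh : ∀ {n} {w : Vec ℕ n} → Central w → Central (l ∷ h ∷ w)
  cons-lh t with cons-h t
  ... | as , ls = inj₁ refl ∷ as , (λ { (_ , ()) }) ∷ ls

  enumerate₀ : Enumeration (Central {0})
  enumerate₀ = singleton [] ([] , []) (λ { {[]} _ → refl })

  -- A leading `h` may be followed by any central word, a leading `l` only by `h` and then any
  -- central word: the Fibonacci recursion. In length one the `l` stands alone.
  enumerate : ∀ n → Enumeration (Central {n})
  enumerate zero          = enumerate₀
  enumerate (suc zero)    = union (h ∷_) (l ∷_) ∷-injectiveʳ ∷-injectiveʳ (λ ())
    cons-h (λ { {[]} _ → inj₁ refl ∷ [] , [-] })
    (λ { (inj₁ refl ∷ [] , _) → inj₂ (_ , refl , [] , [])
       ; (inj₂ refl ∷ [] , _) → inj₁ (_ , refl , [] , []) })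
    enumerate₀ enumerate₀
  enumerate (suc (suc n)) = union (h ∷_) (λ w → l ∷ h ∷ w) ∷-injectiveʳ (∷-injectiveʳ ∘ ∷-injectiveʳ) (λ ())
    cons-h cons-lh
    (λ { (inj₂ refl ∷ as , ls) → inj₁ (_ , refl , as , Linked.tail ls)
       ; (inj₁ refl ∷ inj₂ refl ∷ as , _ ∷ ls) → inj₂ (_ , refl , as , Linked.tail ls)
       ; (inj₁ refl ∷ inj₁ refl ∷ _ , ¬ll ∷ _) → contradiction (refl , refl) ¬ll })
    (enumerate (suc n)) (enumerate n)

  size-enumerate : ∀ n → size (enumerate n) ≡ F (n + 2)
  size-enumerate n = trans (go n) (cong F (+-comm 2 n))
    where
    -- In the form `F (2 + n)` the Fibonacci recursion holds by computation.
    go : ∀ n → size (enumerate n) ≡ F (2 + n)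
    go zero          = refl
    go (suc zero)    = refl
    go (suc (suc n)) = trans (length-map-++-map (list (enumerate (suc n))) (list (enumerate n)))
      (cong₂ _+_ (go (suc n)) (go n))

  -- The isomorphism with the Fibonacci cube

  fromBool : Bool → ℕ
  fromBool true  = l
  fromBool false = h

  toBool : ℕ → Bool
  toBool t = does (t ≟ l)

  toBool∘fromBool : ∀ b → toBool (fromBool b) ≡ b
  toBool∘fromBool true  = dec-true (l ≟ l) refl
  toBool∘fromBool false = dec-false (h ≟ l) 1+n≢n

  fromBool∘toBool : ∀ {t} → Letter t → fromBool (toBool t) ≡ t
  fromBool∘toBool (inj₁ refl) rewrite toBool∘fromBool true  = refl
  fromBool∘toBool (inj₂ refl) rewrite toBool∘fromBool false = refl

  fromBool-injective : ∀ {b c} → fromBool b ≡ fromBool c → b ≡ c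
  fromBool-injective {b} {c} e = trans (sym (toBool∘fromBool b)) (trans (cong toBool e) (toBool∘fromBool c))

  fromBool-letter : ∀ b → Letter (fromBool b)
  fromBool-letter true  = inj₁ refl
  fromBool-letter false = inj₂ refl

  toBits : ∀ {n} → Vec ℕ n → Vec Bool n
  toBits = Vec.map toBool

  fromBits : ∀ {n} → Vec Bool n → Vec ℕ n
  fromBits = Vec.map fromBool

  toBits∘fromBits : ∀ {n} (bs : Vec Bool n) → toBits (fromBits bs) ≡ bs
  toBits∘fromBits []       = refl
  toBits∘fromBits (b ∷ bs) = cong₂ _∷_ (toBool∘fromBool b) (toBits∘fromBits bs)

  fromBits∘toBits : ∀ {n} {w : Vec ℕ n} → All Letter w → fromBits (toBits w) ≡ w
  fromBits∘toBits []       = refl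
  fromBits∘toBits (a ∷ as) = cong₂ _∷_ (fromBool∘toBool a) (fromBits∘toBits as)

  toBits-sparse : ∀ {n} {w : Vec ℕ n} → Central w → NoTwoConsecutive true (toBits w)
  toBits-sparse ([] , _)      = []
  toBits-sparse (_ ∷ [] , _)  = [-]
  toBits-sparse (a ∷ b ∷ as , ab ∷ ls) =
    (λ { (ta , tb) → ab (true⇒l a ta , true⇒l b tb) }) ∷ toBits-sparse (b ∷ as , ls)
    where
    true⇒l : ∀ {t} → Letter t → toBool t ≡ true → t ≡ l
    true⇒l a e = trans (sym (fromBool∘toBool a)) (cong fromBool e)

  fromBits-central : ∀ {n} {bs : Vec Bool n} → NoTwoConsecutive true bs → Central (fromBits bs)
  fromBits-central []  = [] , []
  fromBits-central [-] = fromBool-letter _ ∷ [] , [-]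
  fromBits-central {bs = b ∷ c ∷ bs} (bc ∷ ls) with fromBits-central ls
  ... | as , ls′ = fromBool-letter b ∷ as ,
    (λ { (eb , ec) → bc (fromBool-injective eb , fromBool-injective ec) }) ∷ ls′

  central↔fibonacci : ∀ n → Inverse (subset (setoid (Vec ℕ n)) Central) (Graph.vertices (FibonacciCube n))
  central↔fibonacci n = record
    { to        = λ { (w , t) → toBits w , toBits-sparse t }
    ; from      = λ { (bs , s) → fromBits bs , fromBits-central s }
    ; to-cong   = cong toBits
    ; from-cong = cong fromBits
    ; inverse   = (λ { {bs , _} refl → toBits∘fromBits bs }) , (λ { {_ , as , _} refl → fromBits∘toBits as })
    }

  fromBool<k : ∀ b → fromBool b < k
  fromBool<k b = letter<k (fromBool-letter b)

  -- Translated bit strings have no letter `k`, so a merge cannot occur and an increment changes one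
  -- letter, hence one bit. The words are tied to the bits by equations so that the move can be
  -- matched on.
  raise⇒differ : ∀ {n} {v w : Vec ℕ n} bs cs → v ≡ fromBits bs → w ≡ fromBits cs → Raise k v w → DifferInExactlyOne bs cs
  raise⇒differ (b ∷ bs) (c ∷ cs) d e (incr _) =
    zero , (λ { refl → 1+n≢n (trans (∷-injectiveˡ e) (sym (∷-injectiveˡ d))) }) ,
    λ { zero ≢ → contradiction refl ≢ ; (suc j) _ → cong (λ v → lookup v j) (fromBits-injective (trans (sym (∷-injectiveʳ d)) (∷-injectiveʳ e))) }
    where
    fromBits-injective : ∀ {n} {bs cs : Vec Bool n} → fromBits bs ≡ fromBits cs → bs ≡ cs
    fromBits-injective {bs = bs} {cs} e = trans (sym (toBits∘fromBits bs)) (trans (cong toBits e) (toBits∘fromBits cs))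
  raise⇒differ _ (c ∷ _) _ e (merge _) = contradiction (fromBool<k c) (<-irrefl (sym (∷-injectiveˡ e)))
  raise⇒differ (b ∷ bs) (c ∷ cs) d e (there r) with raise⇒differ bs cs (∷-injectiveʳ d) (∷-injectiveʳ e) r
  ... | i , ≢ᵢ , same = suc i , ≢ᵢ ,
    λ { zero _ → fromBool-injective (trans (sym (∷-injectiveˡ d)) (∷-injectiveˡ e)) ; (suc j) ≢ → same j (≢ ∘ cong suc) }

  -- Flipping a bit exchanges `l` and `h = suc l`, which are consecutive letters below `k`.
  differ⇒raise : ∀ {n} (bs cs : Vec Bool n) → DifferInExactlyOne bs cs →
                 Raise k (fromBits bs) (fromBits cs) ⊎ Raise k (fromBits cs) (fromBits bs)
  differ⇒raise (b ∷ bs) (c ∷ cs) (zero , ≢₀ , same)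
    rewrite lookup-ext bs cs (λ j → same (suc j) λ ()) = flip b c ≢₀
    where
    flip : ∀ {n} {w : Vec ℕ n} b c → b ≢ c →
           Raise k (fromBool b ∷ w) (fromBool c ∷ w) ⊎ Raise k (fromBool c ∷ w) (fromBool b ∷ w)
    flip true  true  ≢ = contradiction refl ≢
    flip true  false _ = inj₁ (incr (fromBool<k false))
    flip false true  _ = inj₂ (incr (fromBool<k false))
    flip false false ≢ = contradiction refl ≢
  differ⇒raise (b ∷ bs) (c ∷ cs) (suc i , ≢ᵢ , same)
    rewrite same zero (λ ()) =
    Sum.map there there (differ⇒raise bs cs (i , ≢ᵢ , λ j ≢ → same (suc j) (≢ ∘ suc-injective)))

  center≅fibonacci : ∀ n → induced (PellGraph n k) (PellCenter n k) ≅ FibonacciCube n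
  center≅fibonacci n = record
    { bijection = Composition.inverse (Symmetry.inverse (words↔center (center n))) (central↔fibonacci n)
    ; preserves = λ u v → mk⇔ (forth u v) (back u v)
    }
    where
    open Graph (induced (PellGraph n k) (PellCenter n k)) using (Adj) renaming (Vertex to CenterVertex)

    word : CenterVertex → Vec ℕ n
    word ((w , _) , _) = w

    word≡ : ∀ u → fromBits (toBits (word u)) ≡ word u
    word≡ ((w , p) , c) = fromBits∘toBits (proj₁ (proj₁ (center n) (p , c)))

    differ-sym : ∀ (bs cs : Vec Bool n) → DifferInExactlyOne bs cs → DifferInExactlyOne cs bs
    differ-sym _ _ (i , ≢ᵢ , same) = i , ≢ᵢ ∘ sym , λ j ≢ → sym (same j ≢)

    forth : ∀ u v → Adj u v → DifferInExactlyOne (toBits (word u)) (toBits (word v))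
    forth u v (inj₁ r) = raise⇒differ _ _ (sym (word≡ u)) (sym (word≡ v)) r
    forth u v (inj₂ r) = differ-sym (toBits (word v)) (toBits (word u)) (raise⇒differ _ _ (sym (word≡ v)) (sym (word≡ u)) r)

    back : ∀ u v → DifferInExactlyOne (toBits (word u)) (toBits (word v)) → Adj u v
    back u v d = subst₂ (λ x y → Raise k x y ⊎ Raise k y x) (word≡ u) (word≡ v)
      (differ⇒raise (toBits (word u)) (toBits (word v)) d)

-- Odd k

module Words (a b : ℕ) (a≢b : a ≢ b) where

  Letter : Pred ℕ 0ℓ
  Letter t = t ≡ a ⊎ t ≡ b

  -- OddWord and EvenWord describe Ψ and Φ letter by letter: after the first block ba
  -- of a word in Φ, the remaining letters read like a word in Ψ.
  data OddWord : ∀ {n} → Vec ℕ n → Set where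
    end  : OddWord (a ∷ [])
    more : ∀ {n x} {w : Vec ℕ n} → Letter x → OddWord w → OddWord (a ∷ x ∷ w)

  data EvenWord : ∀ {n} → Vec ℕ n → Set where
    []   : EvenWord []
    more : ∀ {n x} {w : Vec ℕ n} → Letter x → EvenWord w → EvenWord (a ∷ x ∷ w)
    turn : ∀ {n} {w : Vec ℕ n} → OddWord w → EvenWord (b ∷ w)

  oddWord-letters : ∀ {n} {w : Vec ℕ n} → OddWord w → All Letter w
  oddWord-letters end        = inj₁ refl ∷ []
  oddWord-letters (more t o) = inj₁ refl ∷ t ∷ oddWord-letters o

  evenWord-letters : ∀ {n} {w : Vec ℕ n} → EvenWord w → All Letter w
  evenWord-letters []         = []
  evenWord-letters (more t e) = inj₁ refl ∷ t ∷ evenWord-letters e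
  evenWord-letters (turn o)   = inj₂ refl ∷ oddWord-letters o

  aa ab ba : List ℕ
  aa = a ∷ a ∷ []
  ab = a ∷ b ∷ []
  ba = b ∷ a ∷ []

  Block : Pred (List ℕ) 0ℓ
  Block = _∈ (aa ∷ ab ∷ ba ∷ [])

  Ordered : List ℕ → List ℕ → Set
  Ordered earlier later = ¬ (earlier ≡ ba × later ≡ ab)

  -- These are the blocks that may still occur after a `ba`.
  Late : Pred (List ℕ) 0ℓ
  Late s = s ≡ aa ⊎ s ≡ ba

  late⇒block : ∀ {s} → Late s → Block s
  late⇒block (inj₁ e) = here e
  late⇒block (inj₂ e) = there (there (here e))

  late⇒ordered : ∀ {s t} → Late t → Ordered s t
  late⇒ordered (inj₁ refl) (_ , e) = a≢b (List.∷-injectiveˡ (List.∷-injectiveʳ e))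
  late⇒ordered (inj₂ refl) (_ , e) = a≢b (sym (List.∷-injectiveˡ e))

  allLate⇒ordered : ∀ {ss} → Allˡ Late ss → AllPairs Ordered ss
  allLate⇒ordered []       = []
  allLate⇒ordered (_ ∷ ls) = Allˡ.map late⇒ordered ls ∷ allLate⇒ordered ls

  -- An odd word has `a` at all its odd positions. One letter in front shifts the pairing, so that
  -- every pair ends in `a`.
  oddWord-blocks : ∀ {n x} {w : Vec ℕ n} → Letter x → OddWord w →
                   ∃[ ss ] toList (x ∷ w) ≡ List.concat ss × Allˡ Late ss
  oddWord-blocks {x = x} t end = (x ∷ a ∷ []) ∷ [] , refl , Sum.map (cong (λ x → x ∷ a ∷ [])) (cong (λ x → x ∷ a ∷ [])) t ∷ []
  oddWord-blocks {x = x} t (more t′ o) with oddWord-blocks t′ o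
  ... | ss , e , ls = (x ∷ a ∷ []) ∷ ss , cong (λ w → x ∷ a ∷ w) e ,
    Sum.map (cong (λ x → x ∷ a ∷ [])) (cong (λ x → x ∷ a ∷ [])) t ∷ ls

  evenWord⇒Φ : ∀ {n} {w : Vec ℕ n} → EvenWord w → Φ n a b w
  evenWord⇒Φ []       = [] , refl , [] , []
  evenWord⇒Φ (turn o) with oddWord-blocks (inj₂ refl) o
  ... | ss , e , ls = ss , e , Allˡ.map late⇒block ls , allLate⇒ordered ls
  evenWord⇒Φ (more {x = x} t w) with evenWord⇒Φ w
  ... | ss , e , bs , os = (a ∷ x ∷ []) ∷ ss , cong (λ w → a ∷ x ∷ w) e , block t ∷ bs ,
    Allˡ.universal (λ { _ (e , _) → a≢b (List.∷-injectiveˡ e) }) ss ∷ os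
    where
    block : ∀ {x} → Letter x → Block (a ∷ x ∷ [])
    block (inj₁ refl) = here refl
    block (inj₂ refl) = there (here refl)

  -- The letters of `w` are known only through an equation on `toList w`; letting `P` range over all
  -- lengths allows the length to be refined along with them.
  peel : ∀ {n c d cs} (P : ∀ {n} → Vec ℕ n → Set) (w : Vec ℕ n) → toList w ≡ c ∷ d ∷ cs →
         (∀ {m} (v : Vec ℕ m) → toList v ≡ cs → P (c ∷ d ∷ v)) → P w
  peel P (x ∷ y ∷ w) e f with List.∷-injective e
  ... | refl , e′ with List.∷-injective e′
  ... | refl , e″ = f w e″

  -- The extra `a` is the second letter of a preceding `ba`. It shifts the pairing back: the blocks
  -- `xa` following it are regrouped as `ax`, with a final `a` left over.
  late⇒oddWord : ∀ {n} (w : Vec ℕ n) ss → toList w ≡ List.concat ss → Allˡ Block ss →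
                 Allˡ (Ordered ba) ss → OddWord (a ∷ w)
  late⇒oddWord []      []       _ _ _ = end
  late⇒oddWord w (_ ∷ ss) e (here refl ∷ bs) (_ ∷ os) =
    peel (λ v → OddWord (a ∷ v)) w e λ v e → more (inj₁ refl) (late⇒oddWord v ss e bs os)
  late⇒oddWord w (_ ∷ ss) e (there (here refl) ∷ bs) (o ∷ os) = contradiction (refl , refl) o
  late⇒oddWord w (_ ∷ ss) e (there (there (here refl)) ∷ bs) (_ ∷ os) =
    peel (λ v → OddWord (a ∷ v)) w e λ v e → more (inj₂ refl) (late⇒oddWord v ss e bs os)

  Φ⇒evenWord : ∀ {n} {w : Vec ℕ n} → Φ n a b w → EvenWord w
  Φ⇒evenWord {w = w} (ss , e , bs , os) = go w ss e bs os
    where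
    go : ∀ {n} (w : Vec ℕ n) ss → toList w ≡ List.concat ss → Allˡ Block ss → AllPairs Ordered ss → EvenWord w
    go [] [] _ _ _ = []
    go w (_ ∷ ss) e (here refl ∷ bs) (_ ∷ os) =
      peel EvenWord w e λ v e → more (inj₁ refl) (go v ss e bs os)
    go w (_ ∷ ss) e (there (here refl) ∷ bs) (_ ∷ os) =
      peel EvenWord w e λ v e → more (inj₂ refl) (go v ss e bs os)
    go w (_ ∷ ss) e (there (there (here refl)) ∷ bs) (o ∷ _) =
      peel EvenWord w e λ v e → turn (late⇒oddWord v ss e bs o)

  evenWord≐Φ : ∀ n → EvenWord ≐ Φ n a b
  evenWord≐Φ n = evenWord⇒Φ , Φ⇒evenWord

  2∤1 : 2 ∤ 1
  2∤1 d with ∣⇒≤ d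
  ... | s≤s ()

  oddWord-head : ∀ {n} {w : Vec ℕ n} → OddWord w → List.head (toList w) ≡ just a
  oddWord-head end        = refl
  oddWord-head (more _ _) = refl

  oddWord-last : ∀ {n} {w : Vec ℕ n} → OddWord w → List.last (toList w) ≡ just a
  oddWord-last end                     = refl
  oddWord-last (more _ end)            = refl
  oddWord-last (more _ o@(more _ _))   = oddWord-last o

  oddWord-sparse : ∀ {n} {w : Vec ℕ n} → OddWord w → NoTwoConsecutive b w
  oddWord-sparse end                   = [-]
  oddWord-sparse (more _ end)          = (a≢b ∘ proj₁) ∷ (a≢b ∘ proj₂) ∷ [-]
  oddWord-sparse (more _ o@(more _ _)) = (a≢b ∘ proj₁) ∷ (a≢b ∘ proj₂) ∷ oddWord-sparse o

  -- Removing two letters of the run leaves an odd word again. The descent cannot end at zero, since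
  -- the odd word left over starts with `a` and would prolong the run.
  oddWord-firstRun : ∀ {n} {w : Vec ℕ n} → OddWord w → ∀ m {ys} →
                     toList w ≡ List.replicate m a ++ ys → List.head ys ≢ just a → 2 ∤ m
  oddWord-firstRun o          zero          refl h = contradiction (oddWord-head o) h
  oddWord-firstRun o          (suc zero)    _    _ = 2∤1
  oddWord-firstRun (more _ o) (suc (suc m)) e    h =
    oddWord-firstRun o m (List.∷-injectiveʳ (List.∷-injectiveʳ e)) h ∘ λ d → ∣m+n∣m⇒∣n d ∣-refl

  -- No maximal run starts at an even position, because the letter before it is `a`. So an even
  -- number of letters precedes the run, and after dropping them it is a first run.
  oddWord-runs : ∀ {n} {w : Vec ℕ n} → OddWord w → ∀ m → MaximalRun a (toList w) m → 2 ∤ m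
  oddWord-runs o m ([] , ys , e , _ , _ , h) = oddWord-firstRun o m e h
  oddWord-runs end        m (_ ∷ [] , _ , e , _ , l , _) = contradiction (cong just (sym (List.∷-injectiveˡ e))) l
  oddWord-runs (more _ _) m (_ ∷ [] , _ , e , _ , l , _) = contradiction (cong just (sym (List.∷-injectiveˡ e))) l
  oddWord-runs (more _ o) m (_ ∷ _ ∷ [] , ys , e , 0<m , _ , h) =
    oddWord-runs o m ([] , ys , List.∷-injectiveʳ (List.∷-injectiveʳ e) , 0<m , (λ ()) , h)
  oddWord-runs (more _ o) m (_ ∷ _ ∷ xs@(_ ∷ _) , ys , e , 0<m , l , h) =
    oddWord-runs o m (xs , ys , List.∷-injectiveʳ (List.∷-injectiveʳ e) , 0<m , l , h)

  -- A run at the very start of `v` grows by two letters if `x` is `a`, which keeps its parity, and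
  -- stays maximal if `x` is `b`. Later runs are unaffected.
  runs-tail : ∀ {x} → Letter x → ∀ v → (∀ m → MaximalRun a (a ∷ x ∷ v) m → 2 ∤ m) →
              ∀ m → MaximalRun a v m → 2 ∤ m
  runs-tail t v runs m (xs@(_ ∷ _) , ys , e , 0<m , l , h) =
    runs m (a ∷ _ ∷ xs , ys , cong (λ v → a ∷ _ ∷ v) e , 0<m , l , h)
  runs-tail (inj₁ refl) v runs m ([] , ys , e , 0<m , l , h) =
    runs (2 + m) ([] , ys , cong (λ v → a ∷ a ∷ v) e , s≤s z≤n , l , h) ∘ ∣m∣n⇒∣m+n ∣-refl
  runs-tail (inj₂ refl) v runs m ([] , ys , e , 0<m , l , h) =
    runs m (a ∷ b ∷ [] , ys , cong (λ v → a ∷ b ∷ v) e , 0<m , (λ e → a≢b (sym (just-injective e))) , h)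

  -- The third letter has to be `a`: the beginning `aab` has a run of length two, and `abb` contains
  -- `bb`. Hence two letters can be split off.
  Ψ⇒oddWord : ∀ {n} {w : Vec ℕ n} → Ψ n a b w → OddWord w
  Ψ⇒oddWord {w = x ∷ []} (_ , refl , _) = end
  Ψ⇒oddWord {w = x ∷ y ∷ []} (_ ∷ inj₁ refl ∷ [] , refl , _ , _ , runs) =
    contradiction ∣-refl (runs 2 ([] , [] , refl , s≤s z≤n , (λ ()) , (λ ())))
  Ψ⇒oddWord {w = x ∷ y ∷ []} (_ ∷ inj₂ refl ∷ [] , refl , l , _) = contradiction (sym (just-injective l)) a≢b
  Ψ⇒oddWord {w = x ∷ y ∷ z ∷ w} (_ ∷ t ∷ ts@(inj₁ refl ∷ _) , refl , l , _ ∷ _ ∷ s , runs) =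
    more t (Ψ⇒oddWord (ts , refl , l , s , runs-tail t _ runs))
  Ψ⇒oddWord {w = x ∷ y ∷ z ∷ w} (_ ∷ inj₁ refl ∷ inj₂ refl ∷ _ , refl , _ , _ , runs) =
    contradiction ∣-refl (runs 2 ([] , b ∷ toList w , refl , s≤s z≤n , (λ ()) , λ e → a≢b (sym (just-injective e))))
  Ψ⇒oddWord {w = x ∷ y ∷ z ∷ w} (_ ∷ inj₂ refl ∷ inj₂ refl ∷ _ , refl , _ , _ ∷ ¬bb ∷ _ , _) =
    contradiction (refl , refl) ¬bb

  oddWord≐Ψ : ∀ n → OddWord ≐ Ψ n a b
  oddWord≐Ψ n =
    (λ o → oddWord-letters o , oddWord-head o , oddWord-last o , oddWord-sparse o , oddWord-runs o) , Ψ⇒oddWord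

  -- Counting odd and even words

  LetterThen : ∀ {n} → Pred (Vec ℕ n) 0ℓ → Pred (Vec ℕ (suc n)) 0ℓ
  LetterThen P w = Letter (Vec.head w) × P (Vec.tail w)

  enumerateOdd : ∀ q → Enumeration (OddWord {suc (q * 2)})
  enumerateOdd zero    = singleton _ end (λ { end → refl })
  enumerateOdd (suc q) = union (λ w → a ∷ a ∷ w) (λ w → a ∷ b ∷ w)
    (∷-injectiveʳ ∘ ∷-injectiveʳ) (∷-injectiveʳ ∘ ∷-injectiveʳ) (a≢b ∘ ∷-injectiveˡ ∘ ∷-injectiveʳ)
    (more (inj₁ refl)) (more (inj₂ refl))
    (λ { (more (inj₁ refl) o) → inj₁ (_ , refl , o) ; (more (inj₂ refl) o) → inj₂ (_ , refl , o) })
    (enumerateOdd q) (enumerateOdd q)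

  enumerateLetterThen : ∀ {n} {P : Pred (Vec ℕ n) 0ℓ} → Enumeration P → Enumeration (LetterThen P)
  enumerateLetterThen E = union (a ∷_) (b ∷_) ∷-injectiveʳ ∷-injectiveʳ (a≢b ∘ ∷-injectiveˡ)
    (inj₁ refl ,_) (inj₂ refl ,_)
    (λ { {_ ∷ _} (inj₁ refl , p) → inj₁ (_ , refl , p) ; {_ ∷ _} (inj₂ refl , p) → inj₂ (_ , refl , p) })
    E E

  enumerateEven : ∀ q → Enumeration (EvenWord {q * 2})
  enumerateEven zero    = singleton [] [] (λ { [] → refl })
  enumerateEven (suc q) = union (a ∷_) (b ∷_) ∷-injectiveʳ ∷-injectiveʳ (a≢b ∘ ∷-injectiveˡ)
    (λ { {_ ∷ _} (t , e) → more t e }) turn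
    (λ { (more t e) → inj₁ (_ , refl , t , e) ; (turn o) → inj₂ (_ , refl , o) })
    (enumerateLetterThen (enumerateEven q)) (enumerateOdd q)

  size-odd : ∀ q → size (enumerateOdd q) ≡ 2 ^ q
  size-odd zero    = refl
  size-odd (suc q) = trans (length-map-++-map (list (enumerateOdd q)) (list (enumerateOdd q)))
    (trans (cong₂ _+_ (size-odd q) (size-odd q)) (cong (2 ^ q +_) (sym (+-identityʳ (2 ^ q)))))

  -- The sizes satisfy `e (suc q) = 2 * e q + 2 ^ q`. The factor 4 avoids the exponent `q - 2`,
  -- which is negative for small `q`.
  size-even : ∀ q → 4 * size (enumerateEven q) ≡ (q * 2 + 4) * 2 ^ q
  size-even zero    = refl
  size-even (suc q) = begin
    4 * size (enumerateEven (suc q))  ≡⟨ cong (4 *_) (length-map-++-map (list E²) (list (enumerateOdd q))) ⟩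
    4 * (size E² + size (enumerateOdd q)) ≡⟨ cong₂ (λ x y → 4 * (x + y)) (length-map-++-map (list E) (list E)) (size-odd q) ⟩
    4 * ((size E + size E) + 2 ^ q)       ≡⟨ expand (size E) (2 ^ q) ⟩
    (4 * size E) * 2 + 4 * 2 ^ q          ≡⟨ cong (λ x → x * 2 + 4 * 2 ^ q) (size-even q) ⟩
    ((q * 2 + 4) * 2 ^ q) * 2 + 4 * 2 ^ q ≡⟨ collect q (2 ^ q) ⟩
    (suc q * 2 + 4) * 2 ^ suc q           ∎
    where
    open ≡-Reasoning
    E  = enumerateEven q
    E² = enumerateLetterThen E
    expand : ∀ e p → 4 * ((e + e) + p) ≡ (4 * e) * 2 + 4 * p
    expand = solve-∀
    collect : ∀ q p → ((q * 2 + 4) * p) * 2 + 4 * p ≡ (suc q * 2 + 4) * (2 * p)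
    collect = solve-∀

-- The center for odd k

module OddCase (h : ℕ) (0<h : 0 < h) where

  open Pell (h + h)
  open Words h (suc h) (1+n≢n ∘ sym)

  letter<k : ∀ {x} → Letter x → x < k
  letter<k (inj₁ refl) = s≤s (m≤m+n h h)
  letter<k (inj₂ refl) = s≤s (+-monoˡ-≤ h 0<h)

  h≤letter : ∀ {x} → Letter x → h ≤ x
  h≤letter (inj₁ refl) = ≤-refl
  h≤letter (inj₂ refl) = n≤1+n h

  letter≤1+h : ∀ {x} → Letter x → x ≤ suc h
  letter≤1+h (inj₁ refl) = n≤1+n h
  letter≤1+h (inj₂ refl) = ≤-refl

  -- This is `⌊nk/2⌋` for `k = 2h + 1`, in the recursive form that matches peeling off pairs.
  radius : ℕ → ℕ
  radius zero          = 0
  radius (suc zero)    = h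
  radius (suc (suc n)) = k + radius n

  h+[1+h+r]≡k+r : ∀ r → h + (suc h + r) ≡ k + r
  h+[1+h+r]≡k+r r = trans (+-suc h (h + r)) (cong suc (sym (+-assoc h h r)))

  radius-even : ∀ q → radius (suc (q * 2)) ≡ h + radius (q * 2)
  radius-even zero    = sym (+-identityʳ h)
  radius-even (suc q) = trans (cong (k +_) (radius-even q)) (x∙yz≈y∙xz +-commutativeSemigroup k h (radius (q * 2)))

  -- The odd word stands for the oddness of `n`. Going from odd to even length adds `h + 1`, the
  -- complement in `k` of the `h` in `radius-even`.
  radius-oddWord : ∀ {n} {w : Vec ℕ n} → OddWord w → radius (suc n) ≡ suc h + radius n
  radius-oddWord end              = +-identityʳ k
  radius-oddWord (more {n} _ o) = trans (cong (k +_) (radius-oddWord o)) (x∙yz≈y∙xz +-commutativeSemigroup k (suc h) (radius n))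

  -- By the triangle inequality in each letter, the gains of `0 0` and `k k` sum to at least
  -- `2k - 1`, so one of them is at least `k`.
  k+κ≤ : ∀ x y → k + (h + h) ≤ (x + y) + (∣ x - k ∣ + ∣ y - h + h ∣)
  k+κ≤ x y = ≤-trans (+-mono-≤ (m≤n+∣n-m∣ k x) (m≤n+∣n-m∣ (h + h) y))
    (≤-reflexive (interchange +-commutativeSemigroup x ∣ x - k ∣ y ∣ y - h + h ∣))

  reach-pair : ∀ {n} {xs : Vec ℕ n} {s} x y → Reach xs s → Reach (x ∷ y ∷ xs) (k + s)
  reach-pair {s = s} x y r with <-≤-connex (x + y) k
  ... | inj₂ k≤x+y = reach-weaken (≤-trans (+-monoˡ-≤ s k≤x+y) (≤-reflexive (+-assoc x y s)))
    (reach-low x (reach-low y r))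
  ... | inj₁ (s≤s x+y≤κ) = reach-weaken (≤-trans (+-monoˡ-≤ s k≤) (≤-reflexive (+-assoc ∣ x - k ∣ _ s)))
    (reach-double x y r)
    where
    k≤ : k ≤ ∣ x - k ∣ + ∣ y - h + h ∣
    k≤ = +-cancelˡ-≤ (h + h) _ _ (≤-trans (≤-reflexive (+-comm (h + h) k)) (≤-trans (k+κ≤ x y) (+-monoˡ-≤ _ x+y≤κ)))

  reach-single : ∀ x → Reach (x ∷ []) h
  reach-single x with ≤-total h x
  ... | inj₁ h≤x = reach-weaken (≤-trans h≤x (m≤m+n x 0)) (reach-low x reach-[])
  ... | inj₂ x≤h = reach-weaken (≤-trans (∣-∣-greatest (+-monoˡ-≤ h x≤h)) (m≤m+n _ 0)) (reach-high x reach-[])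

  reach : ∀ {n} (xs : Vec ℕ n) → Reach xs (radius n)
  reach []           = reach-[]
  reach (x ∷ [])     = reach-single x
  reach (x ∷ y ∷ xs) = reach-pair x y (reach xs)

  single-bound-a : ∀ {i} → i < k → ∣ h - i ∣ ≤ h
  single-bound-a {i} (s≤s i≤κ) = ∣-∣-least (m≤n+m h i) i≤κ

  single-bound : ∀ {x i} → Letter x → i < k → ∣ x - i ∣ ≤ suc h
  single-bound {x} {i} t (s≤s i≤κ) = ∣-∣-least (≤-trans (letter≤1+h t) (m≤n+m (suc h) i))
    (≤-trans i≤κ (+-mono-≤ (h≤letter t) (n≤1+n h)))

  -- The first letter is compared with `k = 2h + 1` and yields at most `h + 1`, the second with
  -- `κ = 2h` and yields at most `h`.
  double-bound : ∀ {x y r R} → Letter x → Letter y → r ≤ R → ∣ x - k ∣ + (∣ y - h + h ∣ + r) ≤ k + R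
  double-bound {x} {y} {R = R} t t′ r≤R = ≤-trans (+-mono-≤ first (+-mono-≤ second r≤R))
    (≤-reflexive (sym (+-assoc (suc h) h R)))
    where
    first : ∣ x - k ∣ ≤ suc h
    first = ∣-∣-least (≤-trans (letter≤1+h t) (m≤n+m (suc h) k))
      (≤-trans (≤-reflexive (sym (+-suc h h))) (+-monoˡ-≤ (suc h) (h≤letter t)))
    second : ∣ y - h + h ∣ ≤ h
    second = ∣-∣-least (≤-trans (letter≤1+h t′) (+-monoˡ-≤ h (≤-trans 0<h (m≤m+n h h)))) (+-monoˡ-≤ h (h≤letter t′))

  -- The opponent's blocks need not respect the pairs of the odd word: a single letter against `a`
  -- leaves the shifted tail `x ∷ w`. Both shapes are therefore bounded together.
  oddWord-bound : ∀ {n} {xs w : Vec ℕ n} → OddWord xs → (p : IsPell k w) → D xs (encode p) ≤ radius n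
  letter∷oddWord-bound : ∀ {n x} {xs : Vec ℕ n} {w : Vec ℕ (suc n)} → Letter x → OddWord xs → (p : IsPell k w) →
                         D (x ∷ xs) (encode p) ≤ radius (suc n)
  oddWord-bound end            (letter l []) = ≤-trans (≤-reflexive (+-identityʳ _)) (single-bound-a l)
  oddWord-bound (more {n} t o) (letter l p) = ≤-trans (+-mono-≤ (single-bound-a l) (letter∷oddWord-bound t o p))
    (≤-reflexive (trans (cong (h +_) (radius-oddWord o)) (h+[1+h+r]≡k+r (radius n))))
  oddWord-bound (more t o)     (double p)   = double-bound (inj₁ refl) t (oddWord-bound o p)
  letter∷oddWord-bound t o           (letter l p) = ≤-trans (+-mono-≤ (single-bound t l) (oddWord-bound o p))
    (≤-reflexive (sym (radius-oddWord o)))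
  letter∷oddWord-bound t end         (double [])  = double-bound t (inj₁ refl) z≤n
  letter∷oddWord-bound t (more t′ o) (double p)   = double-bound t (inj₁ refl) (letter∷oddWord-bound t′ o p)

  -- Again both alignments are bounded together. The shifted tail is allowed `h + 1` beyond the
  -- radius of the even word, which is affordable because the `a` before it yields at most `h`.
  evenWord-bound : ∀ {n} {xs w : Vec ℕ n} → EvenWord xs → (p : IsPell k w) → D xs (encode p) ≤ radius n
  letter∷evenWord-bound : ∀ {n x} {xs : Vec ℕ n} {w : Vec ℕ (suc n)} → Letter x → EvenWord xs → (p : IsPell k w) →
                          D (x ∷ xs) (encode p) ≤ suc h + radius n
  evenWord-bound []             []           = z≤n
  evenWord-bound (turn o)       p            = letter∷oddWord-bound (inj₂ refl) o p
  evenWord-bound (more {n} t e) (letter l p) = ≤-trans (+-mono-≤ (single-bound-a l) (letter∷evenWord-bound t e p))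
    (≤-reflexive (h+[1+h+r]≡k+r (radius n)))
  evenWord-bound (more t e)     (double p)   = double-bound (inj₁ refl) t (evenWord-bound e p)
  letter∷evenWord-bound t e               (letter l p) = +-mono-≤ (single-bound t l) (evenWord-bound e p)
  letter∷evenWord-bound t (more {n} t′ e) (double p)   =
    ≤-trans (double-bound t (inj₁ refl) (letter∷evenWord-bound t′ e p)) (≤-reflexive (x∙yz≈y∙xz +-commutativeSemigroup k (suc h) (radius n)))
  -- The block covers `x` and the turning letter, so an odd word remains; the estimate has one unit
  -- to spare.
  letter∷evenWord-bound t (turn {n} o)    (double p)   = ≤-trans (double-bound t (inj₂ refl) (oddWord-bound o p))
    (≤-trans (≤-reflexive (sym (h+[1+h+r]≡k+r (radius n)))) (+-mono-≤ (n≤1+n h) (≤-reflexive (sym (radius-oddWord o)))))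

  -- A leading `0` forces `x ≤ h`, and a leading `κ = 2h` forces `h ≤ x`.
  within⇒first≡h : ∀ {n x R} {xs : Vec ℕ n} → Within (x ∷ xs) (h + R) → Reach xs R → x ≡ h
  within⇒first≡h {x = x} {R} wi r = ≤-antisym
    (+-cancelʳ-≤ R _ _ (reach≤within wi (reach-low x r)))
    (+-cancelʳ-≤ h _ _ (≤-trans (m≤n+∣n-m∣ (h + h) x)
      (+-monoʳ-≤ x (+-cancelʳ-≤ R _ _ (reach≤within wi (reach-high x r))))))

  balanced : ∀ {x y} → x ≤ suc y → y ≤ suc x → h + h ≤ x + y → x + y ≤ k →
             (x ≡ h × Letter y) ⊎ (x ≡ suc h × y ≡ h)
  balanced {x} {y} x≤1+y y≤1+x κ≤x+y x+y≤k with <-cmp x h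
  -- If `x < h`, then `y ≤ suc x ≤ h`, and the sum falls below `h + h`.
  ... | tri< x<h _ _ = contradiction κ≤x+y (<⇒≱ (+-mono-<-≤ x<h (≤-trans y≤1+x x<h)))
  ... | tri≈ _ refl _ = inj₁ (refl , y-letter)
    where
    y-letter : Letter y
    y-letter with m≤n⇒m<n∨m≡n (+-cancelˡ-≤ h y (suc h) (≤-trans x+y≤k (≤-reflexive (sym (+-suc h h)))))
    ... | inj₁ (s≤s y≤h) = inj₁ (≤-antisym y≤h (+-cancelˡ-≤ h h y κ≤x+y))
    ... | inj₂ y≡1+h     = inj₂ y≡1+h
  ... | tri> _ _ h<x = inj₂ (≤-antisym x≤1+h h<x , y≡h)
    where
    h≤y : h ≤ y
    h≤y = ≤-pred (≤-trans h<x x≤1+y)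
    y≡h : y ≡ h
    y≡h = ≤-antisym (+-cancelˡ-≤ (suc h) y h (≤-trans (+-monoˡ-≤ y h<x) x+y≤k)) h≤y
    x≤1+h : x ≤ suc h
    x≤1+h = subst (λ y → x ≤ suc y) y≡h x≤1+y

  -- The four hypotheses of `balanced` come, in this order, from the opponents starting with `0 κ`,
  -- `κ 0`, `k k` and `0 0`.
  within⇒first-pair : ∀ {n x y R} {xs : Vec ℕ n} → Within (x ∷ y ∷ xs) (k + R) → Reach xs R →
                      (x ≡ h × Letter y) ⊎ (x ≡ suc h × y ≡ h)
  within⇒first-pair {x = x} {y} {R} wi r = balanced
    (+-cancelʳ-≤ ∣ y - h + h ∣ _ _ (≤-trans (gain≤k x ∣ y - h + h ∣ (reach-low x (reach-high y r))) (s≤s (m≤n+∣n-m∣ (h + h) y))))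
    (+-cancelˡ-≤ ∣ x - h + h ∣ _ _ (≤-trans (gain≤k ∣ x - h + h ∣ y (reach-high x (reach-low y r)))
      (≤-trans (s≤s (m≤n+∣n-m∣ (h + h) x)) (≤-reflexive (+-comm (suc x) _)))))
    (+-cancelˡ-≤ k _ _ (≤-trans (k+κ≤ x y) (≤-trans (+-monoʳ-≤ (x + y) (gain≤k ∣ x - k ∣ ∣ y - h + h ∣ (reach-double x y r)))
      (≤-reflexive (+-comm (x + y) k)))))
    (gain≤k x y (reach-low x (reach-low y r)))
    where
    gain≤k : ∀ c d → Reach (x ∷ y ∷ _) (c + (d + R)) → c + d ≤ k
    gain≤k c d far = +-cancelʳ-≤ R _ _ (≤-trans (≤-reflexive (+-assoc c d R)) (reach≤within wi far))

  -- What follows the first letter has even length, so that letter can also be split off alone with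
  -- the bound `h`; this rules out a pair starting with `h + 1`.
  within⇒oddWord : ∀ q (xs : Vec ℕ (suc (q * 2))) → Within xs (radius (suc (q * 2))) → OddWord xs
  within⇒oddWord zero    (x ∷ [])     wi
    rewrite within⇒first≡h (subst (Within (x ∷ [])) (radius-even 0) wi) reach-[] = end
  within⇒oddWord (suc q) (x ∷ y ∷ xs) wi
    with within⇒first≡h (subst (Within _) (radius-even (suc q)) wi) (reach (y ∷ xs)) | within⇒first-pair wi (reach xs)
  ... | refl | inj₁ (_ , t) = more t (within⇒oddWord q xs (within-cancel k (reach-pair x y) wi))
  ... | refl | inj₂ (e , _) = contradiction (sym e) 1+n≢n

  within⇒evenWord : ∀ q (xs : Vec ℕ (q * 2)) → Within xs (radius (q * 2)) → EvenWord xs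
  within⇒evenWord zero    []           _  = []
  within⇒evenWord (suc q) (x ∷ y ∷ xs) wi with within⇒first-pair wi (reach xs)
  ... | inj₁ (refl , t)    = more t (within⇒evenWord q xs (within-cancel k (reach-pair x y) wi))
  -- Against `0` the leading letter gains `h + 1`, precisely the increase of the radius from odd to
  -- even length, so the tail is within its own radius.
  ... | inj₂ (refl , refl) = turn (within⇒oddWord q (h ∷ xs)
    (within-cancel (suc h) (reach-low (suc h)) (subst (Within _) radius≡ wi)))
    where
    radius≡ : k + radius (q * 2) ≡ suc h + radius (suc (q * 2))
    radius≡ = trans (+-assoc (suc h) h _) (cong (suc h +_) (sym (radius-even q)))

  constant-oddWord : ∀ q → OddWord (Vec.replicate (suc (q * 2)) h)
  constant-oddWord zero    = end
  constant-oddWord (suc q) = more (inj₁ refl) (constant-oddWord q)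

  constant-evenWord : ∀ q → EvenWord (Vec.replicate (q * 2) h)
  constant-evenWord zero    = []
  constant-evenWord (suc q) = more (inj₁ refl) (constant-evenWord q)

  center-odd : ∀ q → PellCenterWords (suc (q * 2)) k ≐ OddWord
  center-odd q = center-characterisation OddWord (radius (suc (q * 2))) (All.map letter<k ∘ oddWord-letters) reach
    (λ o → within λ v → oddWord-bound o (proj₂ v)) (within⇒oddWord q _) (_ , constant-oddWord q)

  center-even : ∀ q → PellCenterWords (q * 2) k ≐ EvenWord
  center-even q = center-characterisation EvenWord (radius (q * 2)) (All.map letter<k ∘ evenWord-letters) reach
    (λ e → within λ v → evenWord-bound e (proj₂ v)) (within⇒evenWord q _) (_ , constant-evenWord q)

  center-Φ : ∀ q → PellCenterWords (q * 2) k ≐ Φ (q * 2) h (suc h)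
  center-Φ q = ≐-trans (center-even q) (evenWord≐Φ (q * 2))

  center-Ψ : ∀ q → PellCenterWords (suc (q * 2)) k ≐ Ψ (suc (q * 2)) h (suc h)
  center-Ψ q = ≐-trans (center-odd q) (oddWord≐Ψ (suc (q * 2)))

  cardinality-even : ∀ q → ∃[ c ] HasCardinality (CenterSetoid (q * 2) k) c × 4 * c ≡ (q * 2 + 4) * 2 ^ q
  cardinality-even q = _ , center-cardinality (center-even q) (enumerateEven q) , size-even q

  cardinality-odd : ∀ q → HasCardinality (CenterSetoid (suc (q * 2)) k) (2 ^ q)
  cardinality-odd q = subst (HasCardinality _) (size-odd q) (center-cardinality (center-odd q) (enumerateOdd q))

-- Parity of k and n, and the assembled theorem

n*2≡n+n : ∀ n → n * 2 ≡ n + n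
n*2≡n+n = solve-∀

n*2/2≡n : ∀ n → n * 2 / 2 ≡ n
n*2/2≡n n = m*n/n≡m n 2

odd-form : ∀ n → 2 ∤ n → ∃[ q ] n ≡ suc (q * 2)
odd-form zero          2∤n = contradiction (2 ∣0) 2∤n
odd-form (suc zero)    _   = 0 , refl
odd-form (suc (suc n)) 2∤n with odd-form n (2∤n ∘ ∣m∣n⇒∣m+n ∣-refl)
... | q , refl = suc q , refl

even-k : ∀ {k} → 2 ≤ k → 2 ∣ k → ∃[ l ] k ≡ suc (l + suc l) × k / 2 ≡ suc l
even-k () (divides zero refl)
even-k _  (divides (suc l) refl) = l , n*2≡n+n (suc l) , n*2/2≡n (suc l)

odd-k : ∀ {k} → 2 ≤ k → 2 ∤ k → ∃[ h ] k ≡ suc (h + h) × 0 < h × (k ∸ 1) / 2 ≡ h × (k + 1) / 2 ≡ suc h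
odd-k {k} 2≤k 2∤k with odd-form k 2∤k
-- A zero quotient belongs to `k = 1`, which `2 ≤ k` excludes; this is the source of `0 < h`.
odd-k (s≤s ()) _ | zero , refl
... | suc g , refl = suc g , cong suc (n*2≡n+n (suc g)) , s≤s z≤n , n*2/2≡n (suc g) ,
  trans (cong (_/ 2) (+-comm (suc (suc g * 2)) 1)) (n*2/2≡n (suc (suc g)))

theorem4p2 : (k n : ℕ) → 2 ≤ k → 2 ≤ n →
    ( (2 ∣ k → PellCenterWords n k ≐ Θ n k)
    × (2 ∤ k → 2 ∣ n → PellCenterWords n k ≐ Φ n ((k ∸ 1) / 2) ((k + 1) / 2))
    × (2 ∤ k → 2 ∤ n → PellCenterWords n k ≐ Ψ n ((k ∸ 1) / 2) ((k + 1) / 2)) )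
    × ( (2 ∣ k → HasCardinality (subset (Graph.vertices (PellGraph n k)) (PellCenter n k)) (F (n + 2)))
    × (2 ∤ k → 2 ∣ n → ∃[ c ] HasCardinality (subset (Graph.vertices (PellGraph n k)) (PellCenter n k)) c × 4 * c ≡ (n + 4) * 2 ^ (n / 2))
    × (2 ∤ k → 2 ∤ n → HasCardinality (subset (Graph.vertices (PellGraph n k)) (PellCenter n k)) (2 ^ ((n ∸ 1) / 2))) )
    × (2 ∣ k → induced (PellGraph n k) (PellCenter n k) ≅ FibonacciCube n)
theorem4p2 k n 2≤k 2≤n = (is-Θ , is-Φ , is-Ψ) , (card-Θ , card-Φ , card-Ψ) , iso
  where
  is-Θ : 2 ∣ k → PellCenterWords n k ≐ Θ n k
  is-Θ 2∣k with even-k 2≤k 2∣k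
  ... | l , k≡ , k/2≡ rewrite k/2≡ | k≡ = EvenCase.center l n

  is-Φ : 2 ∤ k → 2 ∣ n → PellCenterWords n k ≐ Φ n ((k ∸ 1) / 2) ((k + 1) / 2)
  is-Φ 2∤k (divides q n≡) with odd-k 2≤k 2∤k
  ... | h , k≡ , 0<h , a≡ , b≡ rewrite a≡ | b≡ | k≡ | n≡ = OddCase.center-Φ h 0<h q

  is-Ψ : 2 ∤ k → 2 ∤ n → PellCenterWords n k ≐ Ψ n ((k ∸ 1) / 2) ((k + 1) / 2)
  is-Ψ 2∤k 2∤n with odd-k 2≤k 2∤k | odd-form n 2∤n
  ... | h , k≡ , 0<h , a≡ , b≡ | q , n≡ rewrite a≡ | b≡ | k≡ | n≡ = OddCase.center-Ψ h 0<h q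

  card-Θ : 2 ∣ k → HasCardinality (CenterSetoid n k) (F (n + 2))
  card-Θ 2∣k with even-k 2≤k 2∣k
  ... | l , refl , _ = subst (HasCardinality _) (size-enumerate n) (center-cardinality (center n) (enumerate n))
    where open EvenCase l

  card-Φ : 2 ∤ k → 2 ∣ n → ∃[ c ] HasCardinality (CenterSetoid n k) c × 4 * c ≡ (n + 4) * 2 ^ (n / 2)
  card-Φ 2∤k (divides q refl) with odd-k 2≤k 2∤k
  ... | h , refl , 0<h , _ rewrite n*2/2≡n q = OddCase.cardinality-even h 0<h q

  card-Ψ : 2 ∤ k → 2 ∤ n → HasCardinality (CenterSetoid n k) (2 ^ ((n ∸ 1) / 2))
  card-Ψ 2∤k 2∤n with odd-k 2≤k 2∤k | odd-form n 2∤n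
  ... | h , refl , 0<h , _ | q , refl rewrite n*2/2≡n q = OddCase.cardinality-odd h 0<h q

  iso : 2 ∣ k → induced (PellGraph n k) (PellCenter n k) ≅ FibonacciCube n
  iso 2∣k with even-k 2≤k 2∣k
  ... | l , refl , _ = EvenCase.center≅fibonacci l n
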